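{- Let $v,w\in S_n$ and let $\mathbf w$ be a reduced word for $w$. Then a $v$-subword $\mathbf v$ of $\mathbf w$ is anti-distinguished if and only if $\mathbf v^{\mathrm{rev}}$ is a distinguished $v^{ -1}$-subword of $\mathbf w^{\mathrm{rev}}$.
   Context: $S_n$ is the symmetric group with simple transpositions $s_1,\dots,s_{n-1}$, and $\le$ is the Bruhat order. A word is a finite sequence $\mathbf w=(s_{i_1},\dots,s_{i_m})$ of simple transpositions; it is a reduced word for $w$ if $w=s_{i_1}\cdots s_{i_m}$ and $m=\ell(w)$. A subword of $\mathbf w$ is a sequence $\mathbf v=(v_1,\dots,v_m)$ with $v_j\in\{s_{i_j},e\}$; it is a $v$-subword if $v_1\cdots v_m=v$. Put $\mathbf v_{(j)}=v_1\cdots v_j$ ($\mathbf v_{(0)}=e$) and $\mathbf v_{\langle j\rangle}=v_jv_{j+1}\cdots v_m$. A subword $\mathbf v$ of $\mathbf w$ is distinguished if $\mathbf v_{(j)}\le\mathbf v_{(j-1)}s_{i_j}$ for all $1\le j\le m$, and anti-distinguished if $\mathbf v_{\langle j\rangle}\le s_{i_j}\mathbf v_{\langle j+1\rangle}$ for all $1\le j\le m-1$. $\mathbf w^{\mathrm{rev}}=(s_{i_m},\dots,s_{i_1})$ and $\mathbf v^{\mathrm{rev}}=(v_m,\dots,v_1)$ denote reversed sequences. -}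

module Defs where

open import Data.Bool.Base using (true; false)
open import Data.Fin.Base using (Fin; zero; suc; toℕ; inject₁)
open import Data.Fin.Permutation using (Permutation′; _⟨$⟩ʳ_; _≈_; _∘ₚ_; id; flip; transpose; remove; lift₀; inverseʳ; lift₀-remove; lift₀-cong; lift₀-comp; lift₀-id; lift₀-transpose)
import Data.Fin.Permutation.Components as PC
open import Data.Fin.Properties using (any?; all?; _≟_)
open import Data.List.Base as List using (List)
open import Data.Nat.Base using (ℕ; zero; suc; pred; _≤_; _<_; z≤n; s≤s)
open import Data.Product.Base using (∃; _×_; _,_; proj₁; proj₂)
open import Data.Sum.Base using (_⊎_)
open import Data.Vec.Base as Vec using (Vec; []; _∷_; _++_; lookup; toList)
open import Function.Base using (_∘_)
open import Relation.Binary.PropositionalEquality using (_≡_; _≢_; refl; sym; trans; cong)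
open import Relation.Nullary using (Dec; yes; no; does; contradiction)
open import Relation.Nullary.Decidable using (map′)
open import Relation.Unary using (Decidable)

private
  variable
    n m k : ℕ

------------------------------------------------------------------------
-- The symmetric group S_n, acting on Fin n = {0, …, n-1}.
-- Its equality is the pointwise _≈_ of Data.Fin.Permutation.

S : ℕ → Set
S n = Permutation′ n

infixl 9 _·_

-- (u · v)(i) = u (v i), whereas _∘ₚ_ composes in diagrammatic order.
_·_ : S n → S n → S n
u · v = v ∘ₚ u

_⁻¹ : S n → S n
u ⁻¹ = flip u

∏ : List (S n) → S n
∏ = List.foldr _·_ id

-- s i is the simple transposition s_{i+1}, exchanging the (0-based) points
-- i and i+1.
s : Fin (pred n) → S n
s {n = suc n} i = transpose (inject₁ i) (suc i)

-- The word (s_{i_1}, …, s_{i_m}), stored as its sequence of indices.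
Word : ℕ → ℕ → Set
Word n m = Vec (Fin (pred n)) m

eval : Word n m → S n
eval 𝐰 = ∏ (List.map s (toList 𝐰))

Expressible : S n → ℕ → Set
Expressible {n} w k = ∃ λ (𝐰 : Word n k) → eval 𝐰 ≈ w

------------------------------------------------------------------------
-- Coxeter length: the least k such that w is a product of k simple
-- transpositions. To define ℓ as a function one needs that the simple
-- transpositions generate S_n and that Expressible is decidable.

private
  anyVec? : ∀ {a} k {P : Vec (Fin a) k → Set} → Decidable P → Dec (∃ P)
  anyVec? zero    P? = map′ ([] ,_) (λ { ([] , p) → p }) (P? [])
  anyVec? (suc k) P? =
    map′ (λ (i , is , p) → i ∷ is , p) (λ { (i ∷ is , p) → i , is , p })
         (any? λ i → anyVec? k λ is → P? (i ∷ is))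

  least : {P : ℕ → Set} → Decidable P → ∀ k → P k →
          ∃ λ l → P l × (∀ j → P j → l ≤ j)
  least P? zero    p = zero , p , λ _ _ → z≤n
  least P? (suc k) p with P? zero
  ... | yes p₀ = zero , p₀ , λ _ _ → z≤n
  ... | no ¬p₀ with l , q , min ← least (P? ∘ suc) k p =
    suc l , q , λ { zero p₀ → contradiction p₀ ¬p₀ ; (suc j) r → s≤s (min j r) }

  eval-++ : ∀ n (𝐮 : Word n k) (𝐰 : Word n m) →
            eval {n} (𝐮 ++ 𝐰) ≈ eval {n} 𝐮 · eval {n} 𝐰
  eval-++ n []      𝐰 i = refl
  eval-++ n (a ∷ 𝐮) 𝐰 i = cong (s {n} a ⟨$⟩ʳ_) (eval-++ n 𝐮 𝐰 i)

  Generated : S n → Set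
  Generated u = ∃ (Expressible u)

  gen-cong : (u v : S n) → u ≈ v → Generated u → Generated v
  gen-cong u v u≈v (k , 𝐰 , eq) = k , 𝐰 , λ i → trans (eq i) (u≈v i)

  gen-s : (i : Fin (pred n)) → Generated (s {n} i)
  gen-s i = 1 , i ∷ [] , λ _ → refl

  gen-· : (u v : S n) → Generated u → Generated v → Generated (u · v)
  gen-· {n} u v (_ , 𝐮 , p) (_ , 𝐯 , q) = _ , 𝐮 ++ 𝐯 , λ i →
    trans (eval-++ n 𝐮 𝐯 i) (trans (p _) (cong (u ⟨$⟩ʳ_) (q i)))

  eval-lift : (𝐰 : Word (suc n) k) →
              eval {suc (suc n)} (Vec.map suc 𝐰) ≈ lift₀ (eval {suc n} 𝐰)
  eval-lift []      i = sym (lift₀-id i)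
  eval-lift (a ∷ 𝐰) i =
    trans (cong (s (suc a) ⟨$⟩ʳ_) (eval-lift 𝐰 i))
      (trans (lift₀-transpose (inject₁ a) (suc a) _)
             (lift₀-comp (eval 𝐰) (s a) i))

  gen-lift : (u : S (suc n)) → Generated u → Generated (lift₀ u)
  gen-lift u (k , 𝐰 , eq) = k , Vec.map suc 𝐰 , λ i →
    trans (eval-lift 𝐰 i) (lift₀-cong _ _ eq i)

  transpose-zero : (j : Fin n) →
    s zero · (lift₀ (transpose zero (suc j)) · s zero) ≈ transpose zero (suc (suc j))
  transpose-zero j zero          = refl
  transpose-zero j (suc zero)    = refl
  transpose-zero j (suc (suc k)) with does (k ≟ j)
  ... | true  = refl
  ... | false = refl

  gen-transpose : (j : Fin (suc n)) → Generated (transpose zero j)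
  gen-transpose zero = 0 , [] , λ { zero → refl ; (suc _) → refl }
  gen-transpose {suc n} (suc zero) = gen-s zero
  gen-transpose {suc (suc n)} (suc (suc j)) = gen-cong
    (s zero · (lift₀ t · s zero)) (transpose zero (suc (suc j))) (transpose-zero j)
    (gen-· (s zero) (lift₀ t · s zero) (gen-s zero)
      (gen-· (lift₀ t) (s zero) (gen-lift t (gen-transpose (suc j))) (gen-s zero)))
    where t = transpose zero (suc j)

  generated : (w : S n) → Generated w
  generated {zero}  w = 0 , [] , λ ()
  generated {suc zero} w = 0 , [] , λ { zero → only (w ⟨$⟩ʳ zero) }
    where
    only : (i : Fin 1) → zero ≡ i
    only zero = refl
  generated {suc (suc n)} w = gen-cong
    (transpose zero a · lift₀ (remove zero w′)) w eq
    (gen-· (transpose zero a) (lift₀ (remove zero w′))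
      (gen-transpose a) (gen-lift (remove zero w′) (generated (remove zero w′))))
    where
    a  = w ⟨$⟩ʳ zero
    w′ = transpose a zero · w
    fixes : w′ ⟨$⟩ʳ zero ≡ zero
    fixes with a ≟ a
    ... | yes _  = refl
    ... | no a≢a = contradiction refl a≢a
    eq : transpose zero a · lift₀ (remove zero w′) ≈ w
    eq i = trans (cong (transpose zero a ⟨$⟩ʳ_) (lift₀-remove w′ fixes i))
                 (PC.transpose-inverse zero a)

  expressible? : (w : S n) → Decidable (Expressible w)
  expressible? w k = anyVec? k λ 𝐰 → all? λ i → (eval 𝐰 ⟨$⟩ʳ i) ≟ (w ⟨$⟩ʳ i)

  shortest : (w : S n) →
             ∃ λ l → Expressible w l × (∀ k → Expressible w k → l ≤ k)
  shortest w with k , e ← generated w = least (expressible? w) k e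

ℓ : S n → ℕ
ℓ w = proj₁ (shortest w)

ℓ-expressible : (w : S n) → Expressible w (ℓ w)
ℓ-expressible w = proj₁ (proj₂ (shortest w))

ℓ-minimal : (w : S n) → Expressible w k → ℓ w ≤ k
ℓ-minimal w = proj₂ (proj₂ (shortest w)) _

IsReducedWord : Word n m → S n → Set
IsReducedWord {m = m} 𝐰 w = eval 𝐰 ≈ w × m ≡ ℓ w

------------------------------------------------------------------------
-- Bruhat order: the reflexive-transitive closure of u → u t, for t a
-- reflection (in S_n: a transposition) with ℓ(u) < ℓ(u t).

infix 4 _⟶_ _≤ᴮ_

_⟶_ : S n → S n → Set
u ⟶ v = ∃ λ i → ∃ λ j → i ≢ j × v ≈ u · transpose i j × ℓ u < ℓ v

-- Star is not used because reflexivity has to hold up to _≈_.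
data _≤ᴮ_ {n : ℕ} : S n → S n → Set where
  ≤ᴮ-refl : ∀ {u v} → u ≈ v → u ≤ᴮ v
  ≤ᴮ-step : ∀ {u v w} → u ⟶ v → v ≤ᴮ w → u ≤ᴮ w

------------------------------------------------------------------------

IsSubword : Vec (S n) m → Word n m → Set
IsSubword 𝐯 𝐰 = ∀ j → lookup 𝐯 j ≈ s (lookup 𝐰 j) ⊎ lookup 𝐯 j ≈ id

IsSubwordFor : S n → Vec (S n) m → Word n m → Set
IsSubwordFor v 𝐯 𝐰 = IsSubword 𝐯 𝐰 × ∏ (toList 𝐯) ≈ v

-- 𝐯 ₍ j ₎ = v_1 ⋯ v_j
_₍_₎ : Vec (S n) m → ℕ → S n
𝐯 ₍ j ₎ = ∏ (List.take j (toList 𝐯))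

-- 𝐯 ⟨ j ⟩ = v_j ⋯ v_m for 1 ≤ j ≤ m + 1; the value at j = 0 is not used.
_⟨_⟩ : Vec (S n) m → ℕ → S n
𝐯 ⟨ j ⟩ = ∏ (List.drop (pred j) (toList 𝐯))

-- Below, j : Fin m stands for the 1-based position suc (toℕ j).

IsDistinguished : Vec (S n) m → Word n m → Set
IsDistinguished {m = m} 𝐯 𝐰 = (j : Fin m) →
  𝐯 ₍ suc (toℕ j) ₎ ≤ᴮ 𝐯 ₍ toℕ j ₎ · s (lookup 𝐰 j)

IsAntiDistinguished : Vec (S n) m → Word n m → Set
IsAntiDistinguished {m = m} 𝐯 𝐰 = (j : Fin m) → suc (toℕ j) < m →
  𝐯 ⟨ suc (toℕ j) ⟩ ≤ᴮ s (lookup 𝐰 j) · 𝐯 ⟨ suc (suc (toℕ j)) ⟩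

{-# OPTIONS --safe #-}

-- Inversion is an automorphism of the Bruhat order: it preserves length, and
-- v = u t gives v⁻¹ = u⁻¹ (u t u⁻¹), where u t u⁻¹ is again a transposition.
-- The letters of a subword are involutions, so the prefixes of 𝐯^rev are the
-- inverses of the suffixes of 𝐯, and inversion exchanges the two families of
-- inequalities. The only inequality of the distinguished condition with no
-- anti-distinguished counterpart is v_m ≤ s_{i_m}, which holds because
-- v_m ∈ {s_{i_m}, e}.

module Submission where

open import Defs
open import Data.Fin.Base using (Fin; zero; suc; toℕ; fromℕ; inject₁; opposite)
open import Data.Fin.Permutation using (_⟨$⟩ʳ_; _⟨$⟩ˡ_; _≈_; id; transpose; inverseˡ; inverseʳ)
open import Data.Fin.Properties using (_≟_; toℕ<n; toℕ-inject₁; opposite-prop; opposite-involutive)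
open import Data.List.Base as List using (List; []; _∷_; _++_; length; take; drop)
open import Data.List.Properties using (unfold-reverse; reverse-++; length-reverse; length-drop; take++drop≡id; drop-all; reverse-map)
open import Data.List.Relation.Unary.All as All using (All; []; _∷_)
import Data.List.Relation.Unary.All.Properties as All
open import Data.Nat.Base using (ℕ; suc; pred; _∸_; _≤_; _<_; z≤n)
open import Data.Nat.Properties using (≤-antisym; ≤-trans; ≤-reflexive; ≤∧≢⇒<; n≤0⇒n≡0; 1+n≢n; +-∸-assoc; ≮⇒≥; _<?_)
open import Data.Product.Base using (_×_; _,_)
open import Data.Sum.Base using (_⊎_; inj₁; inj₂)
open import Data.Vec.Base using (Vec; []; _∷_; _∷ʳ_; lookup; reverse; toList)
open import Data.Vec.Properties using (reverse-∷; toList-reverse; length-toList)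
import Data.Vec.Relation.Unary.All.Properties as VecAll
open import Function.Base using (_∘_)
open import Function.Bundles using (_⇔_; mk⇔; Equivalence)
open import Relation.Binary.PropositionalEquality using (_≡_; _≢_; refl; sym; trans; cong; cong₂; subst; subst₂; module ≡-Reasoning)
open import Relation.Nullary using (Dec; yes; no)
open import Relation.Nullary.Decidable using (dec-true; dec-false)

private
  variable
    A : Set
    n m : ℕ

-- Reversal of lists and vectors

take-length-++ : (xs ys : List A) → take (length xs) (xs ++ ys) ≡ xs
take-length-++ []       ys = refl
take-length-++ (x ∷ xs) ys = cong (x ∷_) (take-length-++ xs ys)

-- Split `xs` at `k`: reversal puts the reversed tail first, and that tail has length exactly
-- `length xs ∸ k`. Truncated subtraction also covers `k` beyond the end, where both sides are
-- empty.
take-reverse : ∀ k (xs : List A) →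
  take (length xs ∸ k) (List.reverse xs) ≡ List.reverse (drop k xs)
take-reverse k xs = begin
  take (length xs ∸ k) (List.reverse xs)
    ≡⟨ cong₂ take len (trans (cong List.reverse (sym (take++drop≡id k xs)))
                             (reverse-++ (take k xs) (drop k xs))) ⟩
  take (length ys) (ys ++ List.reverse (take k xs))
    ≡⟨ take-length-++ ys _ ⟩
  ys ∎
  where
  open ≡-Reasoning
  ys  = List.reverse (drop k xs)
  len = sym (trans (length-reverse (drop k xs)) (length-drop k xs))

lookup-∷ʳ-fromℕ : (xs : Vec A n) (x : A) → lookup (xs ∷ʳ x) (fromℕ n) ≡ x
lookup-∷ʳ-fromℕ []       x = refl
lookup-∷ʳ-fromℕ (_ ∷ xs) x = lookup-∷ʳ-fromℕ xs x

lookup-∷ʳ-inject₁ : (xs : Vec A n) (x : A) (i : Fin n) →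
  lookup (xs ∷ʳ x) (inject₁ i) ≡ lookup xs i
lookup-∷ʳ-inject₁ (_ ∷ xs) x zero    = refl
lookup-∷ʳ-inject₁ (_ ∷ xs) x (suc i) = lookup-∷ʳ-inject₁ xs x i

lookup-reverse : (xs : Vec A n) (i : Fin n) →
  lookup (reverse xs) (opposite i) ≡ lookup xs i
lookup-reverse (x ∷ xs) zero rewrite reverse-∷ x xs =
  lookup-∷ʳ-fromℕ (reverse xs) x
lookup-reverse (x ∷ xs) (suc i) rewrite reverse-∷ x xs =
  trans (lookup-∷ʳ-inject₁ (reverse xs) x (opposite i)) (lookup-reverse xs i)

drop-lookup : (xs : Vec A n) (i : Fin n) →
  drop (toℕ i) (toList xs) ≡ lookup xs i ∷ drop (suc (toℕ i)) (toList xs)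
drop-lookup (x ∷ xs) zero    = refl
drop-lookup (x ∷ xs) (suc i) = drop-lookup xs i

-- Inverses and transpositions

⁻¹-cong : (u v : S n) → u ≈ v → u ⁻¹ ≈ v ⁻¹
⁻¹-cong u v u≈v i = begin
  u ⟨$⟩ˡ i                      ≡⟨ cong (u ⟨$⟩ˡ_) (inverseʳ v) ⟨
  u ⟨$⟩ˡ (v ⟨$⟩ʳ (v ⟨$⟩ˡ i))    ≡⟨ cong (u ⟨$⟩ˡ_) (u≈v _) ⟨
  u ⟨$⟩ˡ (u ⟨$⟩ʳ (v ⟨$⟩ˡ i))    ≡⟨ inverseˡ u ⟩
  v ⟨$⟩ˡ i                      ∎
  where open ≡-Reasoning

⟨$⟩ʳ-injective : (u : S n) {i j : Fin n} → u ⟨$⟩ʳ i ≡ u ⟨$⟩ʳ j → i ≡ j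
⟨$⟩ʳ-injective u eq = trans (sym (inverseˡ u)) (trans (cong (u ⟨$⟩ˡ_) eq) (inverseˡ u))

transpose-matchˡ : (i j : Fin n) → transpose i j ⟨$⟩ʳ i ≡ j
transpose-matchˡ i j rewrite dec-true (i ≟ i) refl = refl

transpose-matchʳ : (i j : Fin n) → transpose i j ⟨$⟩ʳ j ≡ i
transpose-matchʳ i j with j ≟ i
... | yes j≡i = j≡i
... | no _ rewrite dec-true (j ≟ j) refl = refl

transpose-mismatch : (i j : Fin n) {k : Fin n} → k ≢ i → k ≢ j → transpose i j ⟨$⟩ʳ k ≡ k
transpose-mismatch i j {k} k≢i k≢j
  rewrite dec-false (k ≟ i) k≢i | dec-false (k ≟ j) k≢j = refl

-- The case analysis on a transposed point is done once here. `by-cases` receives the decisions as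
-- arguments, so `transpose i j` stays folded in the goal and the three lemmas above apply.
transpose-unique : (i j : Fin n) (f g : Fin n → A) →
  g i ≡ f j → g j ≡ f i → (∀ k → k ≢ i → k ≢ j → g k ≡ f k) →
  ∀ k → g k ≡ f (transpose i j ⟨$⟩ʳ k)
transpose-unique i j f g gi gj gk k = by-cases (k ≟ i) (k ≟ j)
  where
  by-cases : Dec (k ≡ i) → Dec (k ≡ j) → g k ≡ f (transpose i j ⟨$⟩ʳ k)
  by-cases (yes refl) _          = trans gi (cong f (sym (transpose-matchˡ i j)))
  by-cases (no _)     (yes refl) = trans gj (cong f (sym (transpose-matchʳ i j)))
  by-cases (no k≢i)   (no k≢j)   =
    trans (gk k k≢i k≢j) (cong f (sym (transpose-mismatch i j k≢i k≢j)))

-- The inverse of `transpose i j` is by definition `transpose j i`, so this is what makes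
-- transpositions involutive.
transpose-comm : (i j : Fin n) → transpose i j ≈ transpose j i
transpose-comm i j = transpose-unique j i (λ k → k) (transpose i j ⟨$⟩ʳ_)
  (transpose-matchʳ i j) (transpose-matchˡ i j)
  (λ k k≢j k≢i → transpose-mismatch i j k≢i k≢j)

-- The conjugation formula u (i j) u⁻¹ = (u(i) u(j)), multiplied by u on the right to avoid
-- inverses.
transpose-natural : (u : S n) (i j : Fin n) →
  transpose (u ⟨$⟩ʳ i) (u ⟨$⟩ʳ j) · u ≈ u · transpose i j
transpose-natural u i j = transpose-unique i j (u ⟨$⟩ʳ_) _
  (transpose-matchˡ (u ⟨$⟩ʳ i) (u ⟨$⟩ʳ j)) (transpose-matchʳ (u ⟨$⟩ʳ i) (u ⟨$⟩ʳ j))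
  (λ k k≢i k≢j → transpose-mismatch (u ⟨$⟩ʳ i) (u ⟨$⟩ʳ j)
    (k≢i ∘ ⟨$⟩ʳ-injective u) (k≢j ∘ ⟨$⟩ʳ-injective u))

Involutive : S n → Set
Involutive u = u ≈ u ⁻¹

s-involutive : (i : Fin (pred n)) → Involutive (s {n} i)
s-involutive {suc n} i = transpose-comm (inject₁ i) (suc i)

∏-∷ʳ : (us : List (S n)) (v : S n) → ∏ (us List.∷ʳ v) ≈ ∏ us · v
∏-∷ʳ []       v i = refl
∏-∷ʳ (u ∷ us) v i = cong (u ⟨$⟩ʳ_) (∏-∷ʳ us v i)

-- Inverting a product reverses the factors and inverts each one; involutive factors are unchanged
-- by the latter.
∏-reverse : (us : List (S n)) → All Involutive us → ∏ (List.reverse us) ≈ ∏ us ⁻¹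
∏-reverse []       []           i = refl
∏-reverse (u ∷ us) (inv ∷ invs) i rewrite unfold-reverse u us = begin
  ∏ (List.reverse us List.∷ʳ u) ⟨$⟩ʳ i    ≡⟨ ∏-∷ʳ (List.reverse us) u i ⟩
  ∏ (List.reverse us) ⟨$⟩ʳ (u ⟨$⟩ʳ i)     ≡⟨ ∏-reverse us invs _ ⟩
  ∏ us ⟨$⟩ˡ (u ⟨$⟩ʳ i)                    ≡⟨ cong (∏ us ⟨$⟩ˡ_) (inv i) ⟩
  ∏ us ⟨$⟩ˡ (u ⟨$⟩ˡ i)                    ∎
  where open ≡-Reasoning

-- Length

eval-reverse : (𝐰 : Word n m) → eval {n} (reverse 𝐰) ≈ eval {n} 𝐰 ⁻¹
eval-reverse {n} 𝐰 i
  rewrite toList-reverse 𝐰 | reverse-map (s {n}) (toList 𝐰) =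
  ∏-reverse _ (All.map⁺ (All.universal (s-involutive {n}) (toList 𝐰))) i

ℓ-cong : (u v : S n) → u ≈ v → ℓ u ≡ ℓ v
ℓ-cong u v u≈v = ≤-antisym (half v u (sym ∘ u≈v)) (half u v u≈v)
  where
  half : (u v : S _) → u ≈ v → ℓ v ≤ ℓ u
  half u v u≈v with 𝐰 , eq ← ℓ-expressible u = ℓ-minimal v (𝐰 , λ i → trans (eq i) (u≈v i))

-- Reversing a shortest word for `u` gives a word of the same length for its inverse. Applying this
-- to `u ⁻¹` gives the other inequality, since a double inverse acts as `u` by definition.
ℓ-⁻¹ : (u : S n) → ℓ (u ⁻¹) ≡ ℓ u
ℓ-⁻¹ {n} u = ≤-antisym (half u (u ⁻¹) λ _ → refl) (half (u ⁻¹) u λ _ → refl)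
  where
  half : (u v : S n) → u ⁻¹ ≈ v → ℓ v ≤ ℓ u
  half u v eq with 𝐰 , eq′ ← ℓ-expressible u = ℓ-minimal v
    (reverse 𝐰 , λ i → trans (eval-reverse {n} 𝐰 i) (trans (⁻¹-cong (eval 𝐰) u eq′ i) (eq i)))

ℓ-id : ℓ (id {n}) ≡ 0
ℓ-id {n} = n≤0⇒n≡0 (ℓ-minimal (id {n}) ([] , λ _ → refl))

ℓ≡0⇒≈id : (u : S n) → ℓ u ≡ 0 → u ≈ id
ℓ≡0⇒≈id u ℓu≡0 with ℓ u | ℓ-expressible u
ℓ≡0⇒≈id u refl | _ | [] , eq = sym ∘ eq

inject₁≢suc : (i : Fin n) → inject₁ i ≢ suc i
inject₁≢suc i eq = 1+n≢n (sym (trans (sym (toℕ-inject₁ i)) (cong toℕ eq)))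

-- Length zero would make `s i` the identity, but it moves `inject₁ i`.
ℓ-s>0 : (i : Fin (pred n)) → 0 < ℓ (s {n} i)
ℓ-s>0 {suc n} i = ≤∧≢⇒< z≤n λ 0≡ℓ → inject₁≢suc i
  (trans (sym (ℓ≡0⇒≈id (s i) (sym 0≡ℓ) (inject₁ i))) (transpose-matchˡ (inject₁ i) (suc i)))

-- Bruhat order

≤ᴮ-resp-≈ : (u u′ v v′ : S n) → u ≈ u′ → v ≈ v′ → u ≤ᴮ v → u′ ≤ᴮ v′
≤ᴮ-resp-≈ u u′ v v′ u≈u′ v≈v′ (≤ᴮ-refl u≈v) =
  ≤ᴮ-refl λ i → trans (sym (u≈u′ i)) (trans (u≈v i) (v≈v′ i))
≤ᴮ-resp-≈ u u′ v v′ u≈u′ v≈v′ (≤ᴮ-step {v = x} (i , j , i≢j , eq , lt) x≤v) =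
  ≤ᴮ-step (i , j , i≢j , (λ k → trans (eq k) (u≈u′ _)) , subst (_< ℓ x) (ℓ-cong u u′ u≈u′) lt)
          (≤ᴮ-resp-≈ x x v v′ (λ _ → refl) v≈v′ x≤v)

⟶-⁻¹ : (u v : S n) → u ⟶ v → u ⁻¹ ⟶ v ⁻¹
⟶-⁻¹ u v (i , j , i≢j , eq , lt) =
  -- These are the two points exchanged by the conjugate u t u⁻¹.
  u ⟨$⟩ʳ i , u ⟨$⟩ʳ j , i≢j ∘ ⟨$⟩ʳ-injective u , eq′ ,
  subst₂ _<_ (sym (ℓ-⁻¹ u)) (sym (ℓ-⁻¹ v)) lt
  where
  open ≡-Reasoning
  t = transpose (u ⟨$⟩ʳ i) (u ⟨$⟩ʳ j)
  eq′ : v ⁻¹ ≈ u ⁻¹ · t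
  eq′ k = begin
    v ⟨$⟩ˡ k                           ≡⟨ ⁻¹-cong v (u · transpose i j) eq k ⟩
    transpose j i ⟨$⟩ʳ x               ≡⟨ transpose-comm j i x ⟩
    transpose i j ⟨$⟩ʳ x               ≡⟨ inverseˡ u ⟨
    u ⟨$⟩ˡ ((u · transpose i j) ⟨$⟩ʳ x) ≡⟨ cong (u ⟨$⟩ˡ_) (transpose-natural u i j x) ⟨
    u ⟨$⟩ˡ (t ⟨$⟩ʳ (u ⟨$⟩ʳ x))         ≡⟨ cong (λ y → u ⟨$⟩ˡ (t ⟨$⟩ʳ y)) (inverseʳ u) ⟩
    u ⟨$⟩ˡ (t ⟨$⟩ʳ k)                  ∎
    where x = u ⟨$⟩ˡ k

≤ᴮ-⁻¹ : {u v : S n} → u ≤ᴮ v → u ⁻¹ ≤ᴮ v ⁻¹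
≤ᴮ-⁻¹ {u = u} {v} (≤ᴮ-refl u≈v)             = ≤ᴮ-refl (⁻¹-cong u v u≈v)
≤ᴮ-⁻¹ {u = u}     (≤ᴮ-step {v = x} u⟶x x≤v) = ≤ᴮ-step (⟶-⁻¹ u x u⟶x) (≤ᴮ-⁻¹ x≤v)

id≤ᴮs : (i : Fin (pred n)) → id ≤ᴮ s {n} i
id≤ᴮs {suc n} i = ≤ᴮ-step {v = s i}
  (inject₁ i , suc i , inject₁≢suc i , (λ _ → refl) ,
   subst (_< ℓ (s {suc n} i)) (sym (ℓ-id {suc n})) (ℓ-s>0 {suc n} i))
  (≤ᴮ-refl λ _ → refl)

-- Subwords

letter-involutive : (u : S n) (i : Fin (pred n)) → u ≈ s i ⊎ u ≈ id → Involutive u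
letter-involutive u i (inj₁ u≈s) k =
  trans (u≈s k) (trans (s-involutive i k) (⁻¹-cong (s i) u (sym ∘ u≈s) k))
letter-involutive u i (inj₂ u≈id) k = trans (u≈id k) (⁻¹-cong id u (sym ∘ u≈id) k)

letter≤ᴮs : (u : S n) (i : Fin (pred n)) → u ≈ s i ⊎ u ≈ id → u ≤ᴮ s i
letter≤ᴮs u i (inj₁ u≈s)  = ≤ᴮ-refl u≈s
letter≤ᴮs u i (inj₂ u≈id) = ≤ᴮ-resp-≈ id u (s i) (s i) (sym ∘ u≈id) (λ _ → refl) (id≤ᴮs i)

IsAntiDistinguishedAt : Vec (S n) m → Word n m → Fin m → Set
IsAntiDistinguishedAt 𝐯 𝐰 j =
  𝐯 ⟨ suc (toℕ j) ⟩ ≤ᴮ s (lookup 𝐰 j) · 𝐯 ⟨ suc (suc (toℕ j)) ⟩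

IsDistinguishedAt : Vec (S n) m → Word n m → Fin m → Set
IsDistinguishedAt 𝐯 𝐰 j = 𝐯 ₍ suc (toℕ j) ₎ ≤ᴮ 𝐯 ₍ toℕ j ₎ · s (lookup 𝐰 j)

module _ {n m : ℕ} (𝐯 : Vec (S n) m) (𝐰 : Word n m) (sub : IsSubword 𝐯 𝐰) where

  letters-involutive : All Involutive (toList 𝐯)
  letters-involutive = VecAll.toList⁺ (VecAll.lookup⁻ λ j →
    letter-involutive (lookup 𝐯 j) (lookup 𝐰 j) (sub j))

  reverse-isSubword : IsSubword (reverse 𝐯) (reverse 𝐰)
  reverse-isSubword j = subst
    (λ j → lookup (reverse 𝐯) j ≈ s (lookup (reverse 𝐰) j) ⊎ lookup (reverse 𝐯) j ≈ id)
    (opposite-involutive j)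
    (subst₂ (λ u i → u ≈ s i ⊎ u ≈ id)
      (sym (lookup-reverse 𝐯 (opposite j))) (sym (lookup-reverse 𝐰 (opposite j)))
      (sub (opposite j)))

  ∏-reverse-toList : ∏ (toList (reverse 𝐯)) ≈ ∏ (toList 𝐯) ⁻¹
  ∏-reverse-toList i rewrite toList-reverse 𝐯 = ∏-reverse (toList 𝐯) letters-involutive i

  -- Because suffixes are indexed from 1, `𝐯 ⟨ suc k ⟩` omits exactly `k` letters; the remaining
  -- ones, read backwards, open `reverse 𝐯`.
  prefix-reverse : ∀ k → reverse 𝐯 ₍ m ∸ k ₎ ≈ 𝐯 ⟨ suc k ⟩ ⁻¹
  prefix-reverse k i = begin
    ∏ (take (m ∸ k) (toList (reverse 𝐯))) ⟨$⟩ʳ i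
      ≡⟨ cong (λ us → ∏ us ⟨$⟩ʳ i) (cong₂ (λ l → take (l ∸ k)) (sym (length-toList 𝐯)) (toList-reverse 𝐯)) ⟩
    ∏ (take (length (toList 𝐯) ∸ k) (List.reverse (toList 𝐯))) ⟨$⟩ʳ i
      ≡⟨ cong (λ us → ∏ us ⟨$⟩ʳ i) (take-reverse k (toList 𝐯)) ⟩
    ∏ (List.reverse (drop k (toList 𝐯))) ⟨$⟩ʳ i
      ≡⟨ ∏-reverse (drop k (toList 𝐯)) (All.drop⁺ k letters-involutive) i ⟩
    ∏ (drop k (toList 𝐯)) ⟨$⟩ˡ i ∎
    where open ≡-Reasoning

  reverse-distinguishedAt : ∀ j →
    IsAntiDistinguishedAt 𝐯 𝐰 j ⇔ IsDistinguishedAt (reverse 𝐯) (reverse 𝐰) (opposite j)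
  reverse-distinguishedAt j
    rewrite lookup-reverse 𝐰 j
          -- As `toℕ j < m`, the prefix lengths at `opposite j` are `m ∸ toℕ j` and
          -- `m ∸ suc (toℕ j)`. The longer one is rewritten first, while its successor form is still
          -- visible.
          | trans (cong suc (opposite-prop j)) (sym (+-∸-assoc 1 (toℕ<n j)))
          | opposite-prop j
    = mk⇔ to from
    where
    a = lookup 𝐰 j
    x = 𝐯 ⟨ suc (toℕ j) ⟩
    y = 𝐯 ⟨ suc (suc (toℕ j)) ⟩
    p = reverse 𝐯 ₍ m ∸ toℕ j ₎
    q = reverse 𝐯 ₍ m ∸ suc (toℕ j) ₎
    p≈ : p ≈ x ⁻¹
    p≈ = prefix-reverse (toℕ j)
    q·s≈ : q · s a ≈ (s a · y) ⁻¹
    q·s≈ i = trans (prefix-reverse (suc (toℕ j)) _) (cong (y ⟨$⟩ˡ_) (s-involutive a i))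
    to : x ≤ᴮ s a · y → p ≤ᴮ q · s a
    to = ≤ᴮ-resp-≈ (x ⁻¹) p ((s a · y) ⁻¹) (q · s a) (sym ∘ p≈) (sym ∘ q·s≈) ∘ ≤ᴮ-⁻¹
    from : p ≤ᴮ q · s a → x ≤ᴮ s a · y
    -- Inverting once more returns to the original sides, double inverses cancelling by definition.
    from = ≤ᴮ-resp-≈ (p ⁻¹) x ((q · s a) ⁻¹) (s a · y)
      (⁻¹-cong p (x ⁻¹) p≈) (⁻¹-cong (q · s a) ((s a · y) ⁻¹) q·s≈) ∘ ≤ᴮ-⁻¹

  -- Nothing follows the last letter, so both suffix products collapse and only the comparison of
  -- that letter with its simple transposition remains.
  antiDistinguishedAt-last : ∀ j → m ≤ suc (toℕ j) → IsAntiDistinguishedAt 𝐯 𝐰 j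
  antiDistinguishedAt-last j m≤1+j
    rewrite drop-lookup 𝐯 j
          | drop-all (suc (toℕ j)) (toList 𝐯) (≤-trans (≤-reflexive (length-toList 𝐯)) m≤1+j)
    = ≤ᴮ-resp-≈ u (u · id) (s a) (s a · id) (λ _ → refl) (λ _ → refl) (letter≤ᴮs u a (sub j))
    where
    u = lookup 𝐯 j
    a = lookup 𝐰 j

  antiDistinguishedAt-all : IsAntiDistinguished 𝐯 𝐰 → ∀ j → IsAntiDistinguishedAt 𝐯 𝐰 j
  antiDistinguishedAt-all anti j with suc (toℕ j) <? m
  ... | yes 1+j<m = anti j 1+j<m
  ... | no 1+j≮m  = antiDistinguishedAt-last j (≮⇒≥ 1+j≮m)

proposition6p1 : (n : ℕ) (v w : S n) (m : ℕ) (𝐰 : Word n m) → IsReducedWord 𝐰 w →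
    (𝐯 : Vec (S n) m) → IsSubwordFor v 𝐯 𝐰 →
    IsAntiDistinguished 𝐯 𝐰 ⇔ (IsSubwordFor (v ⁻¹) (reverse 𝐯) (reverse 𝐰) × IsDistinguished (reverse 𝐯) (reverse 𝐰))
proposition6p1 n v w m 𝐰 _ 𝐯 (sub , ∏𝐯≈v) = mk⇔
  (λ anti → (reverse-isSubword 𝐯 𝐰 sub , ∏-reverse≈v⁻¹) , λ j →
    -- Each position of the reversed word is the opposite of one in `𝐰`; its first position comes
    -- from the last of `𝐰`, hence the extension to all positions.
    subst (IsDistinguishedAt (reverse 𝐯) (reverse 𝐰)) (opposite-involutive j)
      (Equivalence.to (reverse-distinguishedAt 𝐯 𝐰 sub (opposite j))
        (antiDistinguishedAt-all 𝐯 𝐰 sub anti (opposite j))))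
  (λ (_ , dist) j _ →
    Equivalence.from (reverse-distinguishedAt 𝐯 𝐰 sub j) (dist (opposite j)))
  where
  ∏-reverse≈v⁻¹ : ∏ (toList (reverse 𝐯)) ≈ v ⁻¹
  ∏-reverse≈v⁻¹ i = trans (∏-reverse-toList 𝐯 𝐰 sub i) (⁻¹-cong (∏ (toList 𝐯)) v ∏𝐯≈v i)
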